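{- There is an $O(dn^2)$-size $\mathrm{Res}^*(d+1)$ refutation of $d\text{ - }\mathrm{RIP}_n$; that is, there is an absolute constant $C$ such that for all integers $d\ge 1$ and $n\ge 2$ there is a $\mathrm{Res}^*(d+1)$ refutation of $d\text{ - }\mathrm{RIP}_n$ of size at most $C\,d\,n^2$.
   Context: Notation: $[n]=\{1,\dots,n\}$. A literal is a propositional variable or its negation. An $e$-conjunction is a conjunction of at most $e$ literals; an $e$-DNF is a disjunction of arbitrarily many $e$-conjunctions. A clause is a disjunction of literals (so it is an $e$-DNF for every $e\ge 1$). The system $\mathrm{Res}(e)$ ($e\ge1$). Lines are $e$-DNFs. Rules ($\mathcal P,\mathcal Q$ are $e$-DNFs, the $\ell_i$ are literals, and all conjunctions have at most $e$ literals): ($\wedge$-introduction) from $\mathcal P\vee\bigwedge_{i\in I_1}\ell_i$ and $\mathcal Q\vee\bigwedge_{i\in I_2}\ell_i$ derive $\mathcal P\vee\mathcal Q\vee\bigwedge_{i\in I_1\cup I_2}\ell_i$, provided $|I_1\cup I_2|\le e$; (cut) from $\mathcal P\vee\bigvee_{i\in I}\ell_i$ and $\mathcal Q\vee\bigwedge_{i\in I}\neg\ell_i$ derive $\mathcal P\vee\mathcal Q$; (weakening 1) from $\mathcal P$ derive $\mathcal P\vee\bigwedge_{i\in I}\ell_i$, provided $|I|\le e$; (weakening 2) from $\mathcal P\vee\bigwedge_{i\in I_1\cup I_2}\ell_i$ derive $\mathcal P\vee\bigwedge_{i\in I_1}\ell_i$. A $\mathrm{Res}(e)$ refutation of a set of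 clauses is a derivation of the empty clause from these clauses (axioms), viewed as a directed acyclic graph whose sources are axioms and whose only sink is the empty clause. Its size is the number of internal nodes, i.e. the number of rule applications. $\mathrm{Res}^*(e)$ is the tree-like version: the graph is required to be a tree (each derived line is used at most once as a premise; axioms may be repeated at different leaves). The contradiction $d\text{ - }\mathrm{RIP}_n$ ($d$-relativized Induction principle). Variables: $P_i$ for $i\in[n]$, $R^p_i$ for $i\in[n]$, $p\in[d]$, and $S_{i,j}$ for $1\le i<j\le n$. Write $\neg\mathcal R_i$ for $\bigvee_{p\in[d]}\neg R^p_i$. The clauses are: $P_1$ and $\neg P_n$; $R^p_1$ and $R^p_n$ for $p\in[d]$; $\bigvee_{j=i+1}^{n}S_{i,j}$ for $i\in[n-1]$; $\neg S_{i,j}\vee\neg\mathcal R_i\vee R^p_j$ for $i,j\in[n]$, $i<j$, $p\in[d]$; $\neg S_{i,j}\vee\neg\mathcal R_i\vee\neg P_i\vee P_j$ for $i,j\in[n]$, $i<j$. -}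

module Defs where

open import Data.Fin.Base using (Fin; toℕ) renaming (_<_ to _<ᶠ_)
open import Data.Fin.Properties using (_<?_)
open import Data.List.Base using (List; []; _∷_; _++_; [_]; map; mapMaybe; length; allFin)
open import Data.List.Properties using (length-map)
open import Data.List.Relation.Binary.BagAndSetEquality using (_∼[_]_; set; [_]-Equality)
import Data.List.Relation.Binary.Subset.Setoid as SetoidSubset
import Data.Maybe.Base as Maybe
open import Data.Nat.Base using (ℕ; suc; _+_; _≤_; _<_; NonZero; >-nonZero⁻¹)
open import Data.Product.Base using (_×_)
open import Level using (0ℓ)
open import Relation.Binary.Bundles using (Setoid)
import Relation.Binary.Construct.On as On
open import Relation.Binary.PropositionalEquality using (_≡_; subst; sym)
open import Relation.Nullary.Decidable using (dec⇒maybe)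
open import Relation.Unary using (Pred)

data Literal (V : Set) : Set where
  pos neg : V → Literal V

∼_ : ∀ {V} → Literal V → Literal V
∼ pos v = neg v
∼ neg v = pos v

Clause : Set → Set
Clause V = List (Literal V)

-- Conjunctions are sets of literals and DNFs are sets of conjunctions. Both are
-- represented by lists, and compared by _≈_ below, which ignores order and
-- repetition at both levels. A set of literals has at most e elements exactly
-- when some list of length at most e enumerates it.

record Conj (V : Set) (e : ℕ) : Set where
  constructor ⋀
  field
    literals : List (Literal V)
    bounded  : length literals ≤ e

open Conj public

DNF : Set → ℕ → Set
DNF V e = List (Conj V e)

module _ {V : Set} {e : ℕ} where

  conjSetoid : Setoid 0ℓ 0ℓ
  conjSetoid = On.setoid {B = Conj V e} ([ set ]-Equality (Literal V)) literals

  open SetoidSubset conjSetoid using (_⊆_)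

  infix 4 _≈_
  infixr 5 _∨_

  _≈_ : DNF V e → DNF V e → Set
  φ ≈ ψ = φ ⊆ ψ × ψ ⊆ φ

  _∨_ : DNF V e → DNF V e → DNF V e
  _∨_ = _++_

  IsUnion : (I₁ I₂ I : Conj V e) → Set
  IsUnion I₁ I₂ I = (literals I₁ ++ literals I₂) ∼[ set ] literals I

  ⋀¬ : Conj V e → Conj V e
  ⋀¬ (⋀ ls b) = ⋀ (map ∼_ ls) (subst (_≤ e) (sym (length-map ∼_ ls)) b)

-- A clause is a DNF all of whose conjunctions are single literals; this needs e ≥ 1.
⋁ : ∀ {V e} .{{_ : NonZero e}} → List (Literal V) → DNF V e
⋁ {e = e} = map (λ ℓ → ⋀ [ ℓ ] (>-nonZero⁻¹ e))

-- χ is the conclusion. The equations make every rule respect _≈_.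

data Rule₁ {V : Set} {e : ℕ} (φ χ : DNF V e) : Set where
  weakening₁ : ∀ 𝒫 I →
    φ ≈ 𝒫 → χ ≈ 𝒫 ∨ [ I ] → Rule₁ φ χ
  weakening₂ : ∀ 𝒫 I₁ I₂ I → IsUnion I₁ I₂ I →
    φ ≈ 𝒫 ∨ [ I ] → χ ≈ 𝒫 ∨ [ I₁ ] → Rule₁ φ χ

data Rule₂ {V : Set} {e : ℕ} .{{_ : NonZero e}} (φ ψ χ : DNF V e) : Set where
  ∧-introduction : ∀ 𝒫 𝒬 I₁ I₂ I → IsUnion I₁ I₂ I →
    φ ≈ 𝒫 ∨ [ I₁ ] → ψ ≈ 𝒬 ∨ [ I₂ ] → χ ≈ 𝒫 ∨ 𝒬 ∨ [ I ] → Rule₂ φ ψ χ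
  cut : ∀ 𝒫 𝒬 I →
    φ ≈ 𝒫 ∨ ⋁ (literals I) → ψ ≈ 𝒬 ∨ [ ⋀¬ I ] → χ ≈ 𝒫 ∨ 𝒬 → Rule₂ φ ψ χ

-- Tree-like derivations: leaves are axioms, internal nodes are rule applications.
data Res* {V : Set} (e : ℕ) .{{_ : NonZero e}} (Γ : Pred (Clause V) 0ℓ) : DNF V e → Set where
  axiom  : ∀ {c} → Γ c → Res* e Γ (⋁ c)
  infer₁ : ∀ {φ χ} → Res* e Γ φ → Rule₁ φ χ → Res* e Γ χ
  infer₂ : ∀ {φ ψ χ} → Res* e Γ φ → Res* e Γ ψ → Rule₂ φ ψ χ → Res* e Γ χ

size : ∀ {V e} .{{_ : NonZero e}} {Γ : Pred (Clause V) 0ℓ} {φ} → Res* e Γ φ → ℕ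
size (axiom _)        = 0
size (infer₁ π _)     = suc (size π)
size (infer₂ π₁ π₂ _) = suc (size π₁ + size π₂)

Res*-Refutation : ∀ {V} (e : ℕ) .{{_ : NonZero e}} → Pred (Clause V) 0ℓ → Set
Res*-Refutation e Γ = Res* e Γ []

-- [n] = {1,…,n} is Fin n, with i ∈ [n] the element whose toℕ is i - 1. The proof in
-- S is irrelevant so that there is one variable for each pair i < j.

data Var (d n : ℕ) : Set where
  P : Fin n → Var d n
  R : Fin n → Fin d → Var d n
  S : (i j : Fin n) → .(i <ᶠ j) → Var d n

module _ {d n : ℕ} where

  ¬𝓡 : Fin n → Clause (Var d n)
  ¬𝓡 i = map (λ p → neg (R i p)) (allFin d)

  ⋁S : Fin n → Clause (Var d n)
  ⋁S i = mapMaybe (λ j → Maybe.map (λ i<j → pos (S i j i<j)) (dec⇒maybe (i <? j))) (allFin n)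

data RIP (d n : ℕ) : Pred (Clause (Var d n)) 0ℓ where
  P-first     : ∀ {i} → toℕ i ≡ 0 → RIP d n [ pos (P i) ]
  P-last      : ∀ {i} → suc (toℕ i) ≡ n → RIP d n [ neg (P i) ]
  R-first     : ∀ {i} p → toℕ i ≡ 0 → RIP d n [ pos (R i p) ]
  R-last      : ∀ {i} p → suc (toℕ i) ≡ n → RIP d n [ pos (R i p) ]
  S-successor : ∀ i → suc (toℕ i) < n → RIP d n (⋁S i)
  R-step      : ∀ i j (i<j : i <ᶠ j) p →
                RIP d n (neg (S i j i<j) ∷ ¬𝓡 i ++ [ pos (R j p) ])
  P-step      : ∀ i j (i<j : i <ᶠ j) →
                RIP d n (neg (S i j i<j) ∷ ¬𝓡 i ++ neg (P i) ∷ pos (P j) ∷ [])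

module Submission where

-- Let G i be the conjunction R¹ᵢ ∧ … ∧ Rᵈᵢ ∧ Pᵢ. Along i = 1, …, n derive Φᵢ = G i ∨ ⋁_{j>i} G j,
-- each from the previous one: the R-step and P-step axioms for (i, j) combine, by d ∧-introductions,
-- to ¬S i j ∨ ¬𝓡 i ∨ ¬P i ∨ G j, and resolving these with ⋁_{j>i} S i j for all j gives
-- ¬𝓡 i ∨ ¬P i ∨ ⋁_{j>i} G j, whose cut with Φᵢ on G i is ⋁_{j>i} G j, the same set as Φᵢ₊₁. Each Φᵢ is
-- used once, so the proof is a tree, with O(d n) rules per i. Finally Φₙ = G n contradicts ¬P n.

open import Defs
open import Algebra.Bundles using (IdempotentCommutativeMonoid; CommutativeMonoid)
import Algebra.Solver.IdempotentCommutativeMonoid as IdempotentCommutativeMonoidSolver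
open import Data.Fin.Base using (Fin; zero; suc; toℕ; fromℕ; inject₁) renaming (_<_ to _<ᶠ_)
open import Data.Fin.Induction using (<-weakInduction)
open import Data.Fin.Properties using (_<?_; toℕ-inject₁; toℕ-fromℕ; ≤fromℕ; toℕ-injective; toℕ<n)
open import Data.List.Base using (List; []; _∷_; _++_; [_]; map; mapMaybe; length; allFin; filter)
open import Data.List.Membership.Propositional using (_∈_; find; lose)
open import Data.List.Membership.Propositional.Properties
  using (∈-filter⁺; ∈-filter⁻; ∈-allFin; ∈-++⁺ˡ; ∈-++⁺ʳ; ∈-++⁻)
import Data.List.Membership.Setoid as SetoidMembership
open import Data.List.Properties
  using (length-map; length-++; length-tabulate; length-filter; map-++; ++-assoc; map-∘; filter-none)
open import Data.List.Relation.Binary.BagAndSetEquality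
  using (_∼[_]_; set; commutativeMonoid; ++-idempotent; empty-unique; map-cong)
open import Data.List.Relation.Unary.All as All using (All; []; _∷_)
open import Data.List.Relation.Unary.All.Properties using (map⁺)
open import Data.List.Relation.Unary.Any using (here)
import Data.Maybe.Base as Maybe
open import Data.Nat.Base using (ℕ; suc; _+_; _*_; _^_; _≤_; _≥_; _<_; z≤n; s≤s; NonZero; >-nonZero⁻¹)
open import Data.Nat.Properties
  using (≤-irrelevant; ≤-refl; ≤-reflexive; ≤-trans; <-trans; n<1+n; n≤1+n; m≤m+n; m≤n+m; ≤⇒≯;
         +-mono-≤; +-monoˡ-≤; +-comm; +-assoc; m≤n⇒m<n∨m≡n; module ≤-Reasoning)
open import Data.Nat.Tactic.RingSolver using (solve-∀)
open import Data.Product.Base using (Σ-syntax; _,_; proj₂)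
open import Data.Sum.Base using (_⊎_; inj₁; inj₂)
open import Function.Base using (_∘_; id)
open import Function.Bundles using (mk⇔; Equivalence)
open import Level using (0ℓ)
open import Relation.Binary.PropositionalEquality
  using (_≡_; refl; sym; trans; cong; subst; cong₂; module ≡-Reasoning)
open import Relation.Nullary.Decidable using (yes; no; dec⇒maybe)
open import Relation.Unary using (Pred; Decidable)

-- Lists up to set equality

setUnion : Set → IdempotentCommutativeMonoid 0ℓ 0ℓ
setUnion A = record
  { Carrier = List A
  ; isIdempotentCommutativeMonoid = record
    { isCommutativeMonoid = CommutativeMonoid.isCommutativeMonoid (commutativeMonoid _ A)
    ; idem = ++-idempotent
    }
  }

module ∪ {A : Set} where
  open IdempotentCommutativeMonoid (setUnion A) public
  open IdempotentCommutativeMonoidSolver (setUnion A) public using (solve; _⊕_; _⊜_) renaming (id to ∅)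

open ∪ using (solve; _⊕_; _⊜_; ∅)

Conj-≡ : ∀ {V e} {I J : Conj V e} → literals I ≡ literals J → I ≡ J
Conj-≡ {I = ⋀ ls b} {⋀ .ls b′} refl = cong (⋀ ls) (≤-irrelevant b b′)

-- `∼[ set ]` is finer than `≈`, since it does not identify different enumerations of one
-- conjunction. It is the relation used below because its laws under `∨` are those of the monoid
-- solver.
∼⇒≈ : ∀ {V e} {φ ψ : DNF V e} → φ ∼[ set ] ψ → φ ≈ ψ
∼⇒≈ φ∼ψ = (λ {I} → ⊆-lift (Equivalence.to φ∼ψ) {I}) , (λ {I} → ⊆-lift (Equivalence.from φ∼ψ) {I})
  where
  open SetoidMembership conjSetoid using () renaming (_∈_ to _∈ᶜ_)
  ⊆-lift : ∀ {φ ψ : DNF _ _} → (∀ {I} → I ∈ φ → I ∈ ψ) → ∀ {I} → I ∈ᶜ φ → I ∈ᶜ ψ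
  ⊆-lift φ⊆ψ I∈φ with J , J∈φ , I≈J ← find I∈φ = lose (φ⊆ψ J∈φ) I≈J

module _ {V : Set} {e : ℕ} .{{_ : NonZero e}} where

  ⟨_⟩ : Literal V → Conj V e
  ⟨ ℓ ⟩ = ⋀ [ ℓ ] (>-nonZero⁻¹ e)

  ⋁-++ : ∀ xs ys → ⋁ {V} {e} (xs ++ ys) ∼[ set ] ⋁ xs ∨ ⋁ ys
  ⋁-++ xs ys = ∪.reflexive (map-++ _ xs ys)

-- Tree-like derivations with size bounds

module Derivations {V : Set} (e : ℕ) .{{_ : NonZero e}} (Γ : Pred (Clause V) 0ℓ) where

  infix 4 ⊢_within_

  -- The conclusion is fixed only up to set equality, so rearranging or merging disjuncts costs no
  -- rule: the next rule applied absorbs the difference.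
  record ⊢_within_ (φ : DNF V e) (k : ℕ) : Set where
    constructor derivation
    field
      {conclusion} : DNF V e
      tree         : Res* e Γ conclusion
      equal        : conclusion ∼[ set ] φ
      bound        : size tree ≤ k

  private variable
    φ ψ 𝒫 𝒬 : DNF V e
    k l : ℕ

  axiom′ : ∀ {c} → Γ c → ⊢ ⋁ c within 0
  axiom′ γ = derivation (axiom γ) ∪.refl z≤n

  resp : φ ∼[ set ] ψ → ⊢ φ within k → ⊢ ψ within k
  resp φ∼ψ (derivation π eq b) = derivation π (∪.trans eq φ∼ψ) b

  relax : k ≤ l → ⊢ φ within k → ⊢ φ within l
  relax k≤l (derivation π eq b) = derivation π eq (≤-trans b k≤l)

  weaken : ∀ I → ⊢ 𝒫 within k → ⊢ 𝒫 ∨ [ I ] within suc k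
  weaken I (derivation π eq b) =
    derivation (infer₁ π (weakening₁ _ I (∼⇒≈ eq) (∼⇒≈ ∪.refl))) ∪.refl (s≤s b)

  weaken-∨ : ∀ 𝒬 → ⊢ 𝒫 within k → ⊢ 𝒬 ∨ 𝒫 within length 𝒬 + k
  weaken-∨ []      π = π
  weaken-∨ (I ∷ 𝒬) π = resp (∪.comm (𝒬 ∨ _) [ I ]) (weaken I (weaken-∨ 𝒬 π))

  shrink : ∀ {I₁ I₂ I} → IsUnion I₁ I₂ I → ⊢ 𝒫 ∨ [ I ] within k → ⊢ 𝒫 ∨ [ I₁ ] within suc k
  shrink {I₁ = I₁} {I₂} {I} u (derivation π eq b) =
    derivation (infer₁ π (weakening₂ _ I₁ I₂ I u (∼⇒≈ eq) (∼⇒≈ ∪.refl))) ∪.refl (s≤s b)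

  conjoin : ∀ {I₁ I₂ I} → IsUnion I₁ I₂ I →
            ⊢ 𝒫 ∨ [ I₁ ] within k → ⊢ 𝒬 ∨ [ I₂ ] within l → ⊢ 𝒫 ∨ 𝒬 ∨ [ I ] within suc (k + l)
  conjoin {I₁ = I₁} {I₂} {I} u (derivation π₁ eq₁ b₁) (derivation π₂ eq₂ b₂) =
    derivation (infer₂ π₁ π₂ (∧-introduction _ _ I₁ I₂ I u (∼⇒≈ eq₁) (∼⇒≈ eq₂) (∼⇒≈ ∪.refl)))
      ∪.refl (s≤s (+-mono-≤ b₁ b₂))

  cut′ : ∀ I → ⊢ 𝒫 ∨ ⋁ (literals I) within k → ⊢ 𝒬 ∨ [ ⋀¬ I ] within l → ⊢ 𝒫 ∨ 𝒬 within suc (k + l)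
  cut′ I (derivation π₁ eq₁ b₁) (derivation π₂ eq₂ b₂) =
    derivation (infer₂ π₁ π₂ (cut _ _ I (∼⇒≈ eq₁) (∼⇒≈ eq₂) (∼⇒≈ ∪.refl))) ∪.refl (s≤s (+-mono-≤ b₁ b₂))

  resolve : ∀ ℓ → ⊢ 𝒫 ∨ [ ⟨ ℓ ⟩ ] within k → ⊢ 𝒬 ∨ [ ⟨ ∼ ℓ ⟩ ] within l → ⊢ 𝒫 ∨ 𝒬 within suc (k + l)
  resolve {𝒬 = 𝒬} {l} ℓ π₁ π₂ =
    -- `⋀¬ ⟨ ℓ ⟩` and `⟨ ∼ ℓ ⟩` differ only in their proofs of the length bound.
    cut′ ⟨ ℓ ⟩ π₁ (subst (λ I → ⊢ 𝒬 ∨ [ I ] within l) (Conj-≡ refl) π₂)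

  -- One ∧-introduction per literal. As `𝒫` absorbs `𝒬`, the side disjuncts stay `𝒫` throughout.
  conjoin-literals : ∀ {I J} ls → literals J ≡ ls ++ literals I → 𝒬 ∨ 𝒫 ∼[ set ] 𝒫 →
                     All (λ ℓ → ⊢ 𝒬 ∨ [ ⟨ ℓ ⟩ ] within 0) ls →
                     ⊢ 𝒫 ∨ [ I ] within k → ⊢ 𝒫 ∨ [ J ] within length ls + k
  conjoin-literals {𝒫 = 𝒫} {k = k} [] eq _ [] π =
    subst (λ I → ⊢ 𝒫 ∨ [ I ] within k) (Conj-≡ (sym eq)) π
  conjoin-literals {𝒬 = 𝒬} {𝒫 = 𝒫} {I = I} {J} (ℓ ∷ ls) eq 𝒬∨𝒫∼𝒫 (πℓ ∷ πs) π =
    resp (∪.trans (∪.sym (∪.assoc 𝒬 𝒫 [ J ])) (∪.∙-congʳ 𝒬∨𝒫∼𝒫))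
      (conjoin {I₂ = J′} (∪.reflexive (sym eq)) πℓ (conjoin-literals ls refl 𝒬∨𝒫∼𝒫 πs π))
    where
    -- The conjunction before `ℓ` is added; it is shorter than `J` and inherits its bound.
    J′ : Conj V e
    J′ = ⋀ (ls ++ literals I)
           (≤-trans (n≤1+n _) (subst (λ ms → length ms ≤ e) eq (bounded J)))

  refutation : ⊢ [] within k → Σ[ π ∈ Res*-Refutation e Γ ] size π ≤ k
  -- Only the empty list is set-equal to `[]`, so the tree itself ends in `[]`.
  refutation (derivation π eq b) with refl ← empty-unique eq = π , b

-- Derivations from the induction principle

module _ (d m : ℕ) where

  private
    n = suc m

  open Derivations (suc d) (RIP d n)

  ¬𝓡∨¬P : Fin n → Clause (Var d n)
  ¬𝓡∨¬P i = ¬𝓡 i ++ [ neg (P i) ]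

  𝓡-literals : Fin n → List (Literal (Var d n))
  𝓡-literals i = map (λ p → pos (R i p)) (allFin d)

  |¬𝓡∨¬P| : ∀ i → length (¬𝓡∨¬P i) ≡ suc d
  |¬𝓡∨¬P| i = begin
    length (¬𝓡 {d} i ++ [ neg (P i) ])  ≡⟨ length-++ (¬𝓡 {d} i) ⟩
    length (¬𝓡 {d} i) + 1               ≡⟨ +-comm (length (¬𝓡 {d} i)) 1 ⟩
    suc (length (¬𝓡 {d} i))             ≡⟨ cong suc (length-map _ (allFin d)) ⟩
    suc (length (allFin d))             ≡⟨ cong suc (length-tabulate {n = d} id) ⟩
    suc d                               ∎
    where open ≡-Reasoning

  ¬𝓡∨¬P-literals : Fin n → Conj (Var d n) (suc d)
  ¬𝓡∨¬P-literals i = ⋀ (¬𝓡∨¬P i) (≤-reflexive (|¬𝓡∨¬P| i))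

  -- The conjunction G i, written as a negation so that it is literally what a cut on
  -- `¬𝓡∨¬P-literals i` removes. Its d + 1 literals fix the parameter of the system.
  𝓡∧P : Fin n → Conj (Var d n) (suc d)
  𝓡∧P i = ⋀¬ (¬𝓡∨¬P-literals i)

  𝓡∧P-literals : ∀ i → literals (𝓡∧P i) ≡ 𝓡-literals i ++ [ pos (P i) ]
  𝓡∧P-literals i = trans (map-++ ∼_ (¬𝓡 i) _) (cong (_++ [ pos (P i) ]) (sym (map-∘ (allFin d))))

  |𝓡-literals| : ∀ i → length (𝓡-literals i) ≡ d
  |𝓡-literals| i = trans (length-map _ (allFin d)) (length-tabulate id)

  All-𝓡 : ∀ {i} {Q : Pred (Literal (Var d n)) 0ℓ} → (∀ p → Q (pos (R i p))) → All Q (𝓡-literals i)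
  All-𝓡 q = map⁺ (All.universal q (allFin d))

  first : ⊢ [ 𝓡∧P zero ] within d + 0
  first = relax (≤-reflexive (cong (_+ 0) (|𝓡-literals| zero)))
    (conjoin-literals {𝒬 = []} {𝒫 = []} {I = ⟨ pos (P zero) ⟩} {𝓡∧P zero} _ (𝓡∧P-literals zero) ∪.refl
      (All-𝓡 (λ p → axiom′ (R-first p refl))) (axiom′ (P-first refl)))

  step : ∀ i j (i<j : i <ᶠ j) → ⊢ ⋁ (neg (S i j i<j) ∷ ¬𝓡∨¬P i) ∨ [ 𝓡∧P j ] within d + 0
  step i j i<j = relax (≤-reflexive (cong (_+ 0) (|𝓡-literals| j)))
    (conjoin-literals {𝒬 = ⋁ side} {𝒫 = ⋁ (side ++ [ neg (P i) ])} {I = ⟨ pos (P j) ⟩} {𝓡∧P j}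
      _ (𝓡∧P-literals j) absorb
      (All-𝓡 (λ p → resp (⋁-++ side _) (axiom′ (R-step i j i<j p))))
      (resp (⋁-++ (side ++ [ neg (P i) ]) _)
        (resp (∪.reflexive (cong ⋁ (sym (++-assoc side [ neg (P i) ] [ pos (P j) ]))))
          (axiom′ (P-step i j i<j)))))
    where
    side : Clause (Var d n)
    side = neg (S i j i<j) ∷ ¬𝓡 i
    -- The R-step axioms contribute only `side`; the literal `neg (P i)` comes from the P-step
    -- axiom.
    absorb : ⋁ side ∨ ⋁ (side ++ [ neg (P i) ]) ∼[ set ] ⋁ (side ++ [ neg (P i) ])
    absorb = ∪.trans (∪.∙-congˡ {x = ⋁ side} (⋁-++ side [ neg (P i) ]))
      (∪.trans (solve 2 (λ a b → a ⊕ (a ⊕ b) ⊜ a ⊕ b) ∪.refl (⋁ side) [ ⟨ neg (P i) ⟩ ])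
        (∪.sym (⋁-++ side [ neg (P i) ])))

  -- Generalises `⋁S i` to a sublist of indices, for the induction that resolves its literals away
  -- one by one.
  ⋁S-among : ∀ {i} → Decidable (i <ᶠ_) → List (Fin n) → Clause (Var d n)
  ⋁S-among i<? = mapMaybe (λ j → Maybe.map (λ i<j → pos (S _ j i<j)) (dec⇒maybe (i<? j)))

  -- Abstract in the decision procedure because does (i <? j) computes to toℕ i <ᵇ toℕ j,
  -- which with i <? j does not abstract.
  eliminate-S : ∀ {i} (i<? : Decidable (i <ᶠ_)) js {𝒫 k} →
                ⊢ ⋁ (⋁S-among i<? js) ∨ ⋁ (¬𝓡∨¬P i) ∨ 𝒫 within k →
                ⊢ ⋁ (¬𝓡∨¬P i) ∨ map 𝓡∧P (filter i<? js) ∨ 𝒫 within length js * suc d + k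
  eliminate-S _ [] π = π
  eliminate-S {i} i<? (j ∷ js) {𝒫} {k} π with i<? j
  -- The d + 1 rules budgeted for this index go unspent.
  ... | no  _   = relax (+-monoˡ-≤ k (m≤n+m _ (suc d))) (eliminate-S i<? js π)
  -- d rules derive `step i j i<j` and one resolves on `S i j`; the new disjunct `𝓡∧P j` joins the
  -- accumulator `𝒫`.
  ... | yes i<j = relax (≤-reflexive (arithmetic (length js * suc d) k d))
    (resp (solve 4 (λ N G g p → N ⊕ G ⊕ g ⊕ p ⊜ N ⊕ (g ⊕ G) ⊕ p) ∪.refl
             (⋁ (¬𝓡∨¬P i)) (map 𝓡∧P (filter i<? js)) [ 𝓡∧P j ] 𝒫)
      (eliminate-S i<? js
        (resp (solve 4 (λ s N g p → (s ⊕ N ⊕ p) ⊕ N ⊕ g ⊜ s ⊕ N ⊕ g ⊕ p) ∪.refl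
                 (⋁ (⋁S-among i<? js)) (⋁ (¬𝓡∨¬P i)) [ 𝓡∧P j ] 𝒫)
          (resolve (pos (S i j i<j))
            (resp (∪.comm [ _ ] (⋁ (⋁S-among i<? js) ∨ ⋁ (¬𝓡∨¬P i) ∨ 𝒫)) π)
            (resp (∪.comm [ _ ] (⋁ (¬𝓡∨¬P i) ∨ [ 𝓡∧P j ])) (step i j i<j))))))
    where
    arithmetic : ∀ a k d → a + suc (k + (d + 0)) ≡ suc d + a + k
    arithmetic = solve-∀

  beyond : Fin n → DNF (Var d n) (suc d)
  beyond i = map 𝓡∧P (filter (i <?_) (allFin n))

  -- The first summand pays for `eliminate-S` over all n indices, the second for weakening `⋁S i` by
  -- the d + 1 literals of `¬𝓡∨¬P i`.
  successor-cost : ℕ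
  successor-cost = n * suc d + (suc d + 0)

  successor : ∀ i → suc (toℕ i) < n → ⊢ beyond i ∨ ⋁ (¬𝓡∨¬P i) within successor-cost
  successor i i<last = relax (≤-reflexive cost)
    (resp (solve 2 (λ N G → N ⊕ G ⊕ ∅ ⊜ G ⊕ N) ∪.refl (⋁ (¬𝓡∨¬P i)) (beyond i))
      (eliminate-S (i <?_) (allFin n)
        (resp (solve 2 (λ N s → N ⊕ s ⊜ s ⊕ N ⊕ ∅) ∪.refl (⋁ (¬𝓡∨¬P i)) (⋁ (⋁S i)))
          (weaken-∨ (⋁ (¬𝓡∨¬P i)) (axiom′ (S-successor i i<last))))))
    where
    cost : length (allFin n) * suc d + (length (⋁ {Var d n} {suc d} (¬𝓡∨¬P i)) + 0) ≡ successor-cost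
    cost = cong₂ (λ a b → a * suc d + (b + 0)) (length-tabulate {n = n} id)
      (trans (length-map _ (¬𝓡∨¬P i)) (|¬𝓡∨¬P| i))

  -- An index exceeds i exactly when it exceeds i + 1 or equals it. Hence passing from ⋁_{j>i} G j
  -- to Φᵢ₊₁ needs no rule.
  beyond-inject₁ : ∀ i → beyond (inject₁ i) ∼[ set ] beyond (suc i) ∨ [ 𝓡∧P (suc i) ]
  beyond-inject₁ i = ∪.trans (map-cong (λ _ → refl) (mk⇔ to from))
    (∪.reflexive (map-++ 𝓡∧P (filter (suc i <?_) (allFin n)) _))
    where
    to : ∀ {j} → j ∈ filter (inject₁ i <?_) (allFin n) → j ∈ filter (suc i <?_) (allFin n) ++ [ suc i ]
    to {j} j∈ with m≤n⇒m<n∨m≡n (subst (_< toℕ j) (toℕ-inject₁ i)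
                     (proj₂ (∈-filter⁻ (inject₁ i <?_) {xs = allFin n} j∈)))
    ... | inj₁ i+1<j = ∈-++⁺ˡ (∈-filter⁺ (suc i <?_) (∈-allFin j) i+1<j)
    ... | inj₂ i+1≡j = ∈-++⁺ʳ _ (here (toℕ-injective (sym i+1≡j)))
    from : ∀ {j} → j ∈ filter (suc i <?_) (allFin n) ++ [ suc i ] → j ∈ filter (inject₁ i <?_) (allFin n)
    from {j} j∈ = ∈-filter⁺ (inject₁ i <?_) (∈-allFin j)
      (subst (_< toℕ j) (sym (toℕ-inject₁ i)) (bound (∈-++⁻ _ j∈)))
      where
      bound : j ∈ filter (suc i <?_) (allFin n) ⊎ j ∈ [ suc i ] → toℕ i < toℕ j
      bound (inj₁ j∈)          = <-trans (n<1+n _) (proj₂ (∈-filter⁻ (suc i <?_) {xs = allFin n} j∈))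
      bound (inj₂ (here refl)) = ≤-refl

  beyond-last : beyond (fromℕ m) ≡ []
  beyond-last = cong (map 𝓡∧P) (filter-none (fromℕ m <?_) (All.universal (λ j → ≤⇒≯ (≤fromℕ j)) (allFin n)))

  |beyond| : ∀ i → length (beyond i) ≤ n
  |beyond| i = begin
    length (beyond i)                   ≡⟨ length-map 𝓡∧P (filter (i <?_) (allFin n)) ⟩
    length (filter (i <?_) (allFin n))  ≤⟨ length-filter (i <?_) (allFin n) ⟩
    length (allFin n)                   ≡⟨ length-tabulate id ⟩
    n                                   ∎
    where open ≤-Reasoning

  -- Each stage costs one `successor` derivation and one cut; the start costs d rules for `first`
  -- and at most n weakenings.
  reach-cost : ℕ → ℕ
  reach-cost i = i * suc successor-cost + (n + (d + 0))

  reach : ∀ i → ⊢ beyond i ∨ [ 𝓡∧P i ] within reach-cost (toℕ i)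
  reach = <-weakInduction _
    (relax (+-monoˡ-≤ _ (|beyond| zero)) (weaken-∨ (beyond zero) first))
    (λ i π → let i′ = inject₁ i in
      -- Both premises of the cut carry `beyond i′`, and the two copies merge.
      resp (∪.trans (∪.idem (beyond i′)) (beyond-inject₁ i))
        (relax (≤-reflexive (trans (sym (+-assoc (suc successor-cost) (toℕ i′ * suc successor-cost) _))
                                   (cong (reach-cost ∘ suc) (toℕ-inject₁ i))))
          (cut′ (¬𝓡∨¬P-literals i′)
            (successor i′ (s≤s (subst (_< m) (sym (toℕ-inject₁ i)) (toℕ<n i)))) π)))

  refute : ⊢ [] within suc (suc (reach-cost m + 0))
  refute = subst (λ i → ⊢ [] within suc (suc (reach-cost i + 0))) (toℕ-fromℕ m)
    (resolve {𝒫 = []} {𝒬 = []} (pos (P last)) (shrink {𝒫 = []} {I₂ = 𝓡∧P last} P∪𝓡∧P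
        (resp (∪.reflexive (cong (_∨ [ 𝓡∧P last ]) beyond-last)) (reach last)))
      (axiom′ (P-last (cong suc (toℕ-fromℕ m)))))
    where
    last = fromℕ m
    -- The second part may be the whole conjunction, since unions may overlap.
    P∪𝓡∧P : IsUnion ⟨ pos (P last) ⟩ (𝓡∧P last) (𝓡∧P last)
    P∪𝓡∧P rewrite 𝓡∧P-literals last =
      solve 2 (λ r p → p ⊕ r ⊕ p ⊜ r ⊕ p) ∪.refl (𝓡-literals last) [ pos (P last) ]

-- The absolute constant

proposition4 : Σ[ C ∈ ℕ ] ((d n : ℕ) → d ≥ 1 → n ≥ 2 →
    Σ[ π ∈ Res*-Refutation (suc d) (RIP d n) ] (size π ≤ C * d * n ^ 2))
proposition4 = 4 , bounded-refutation
  where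
  -- With a = d - 1 and m = n - 1, the difference between 4dn² and the cost is a polynomial with
  -- nonnegative coefficients, written out here as the second summand; `n * (n * 1)` is the unfolded
  -- `n ^ 2`.
  slack : ∀ a m → let d = suc a; n = suc m in
          suc (suc (m * suc (n * suc d + (suc d + 0)) + (n + (d + 0)) + 0))
            + (m * m * (2 + 3 * a) + m * (2 + 6 * a) + 3 * a)
          ≡ 4 * d * (n * (n * 1))
  slack = solve-∀
  bounded-refutation : (d n : ℕ) → d ≥ 1 → n ≥ 2 →
    Σ[ π ∈ Res*-Refutation (suc d) (RIP d n) ] (size π ≤ 4 * d * n ^ 2)
  bounded-refutation (suc a) (suc m) _ _ =
    refutation (relax (≤-trans (m≤m+n _ _) (≤-reflexive (slack a m))) (refute (suc a) m))
    where open Derivations (suc (suc a)) (RIP (suc a) (suc m))
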